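{- The maximum order $n$ of a non-Abelian group having a covering difference set $S$ of cardinality $s=7$ is $n=40$. The set $S=\{1,\,b,\,b^4,\,ba,\,ba^{ -1}b^2,\,ab^{ -1},\,bab^2\}$ in the group $\Gamma_1=\langle a,b\mid a^5=b^8=1,\ bab^{ -1}=a^2\rangle$ (of order $40$) is a $(40,7,1,36)$ almost difference set.
   Context: Let $\Gamma$ be a finite group (written multiplicatively) and $S\subseteq\Gamma$. $S$ is a covering difference set (covering set) of $\Gamma$ if every element of $\Gamma$ is of the form $t\cdot t'^{ -1}$ for some $t,t'\in S$. An $(n,s,\lambda,t)$-almost difference set (ADS) is a subset $S$ of size $s$ of a group of order $n$ such that the multiset of differences $\{t_i\cdot t_j^{ -1}: t_i,t_j\in S\}$ contains exactly $t$ of the non-identity group elements exactly $\lambda$ times each, and all other non-identity group elements exactly $\lambda+1$ times each. -}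

module Defs where

open import Level using (Level; _⊔_; suc; 0ℓ)
open import Algebra.Bundles using (Group; RawMonoid)
open import Algebra.Structures using (IsGroup)
open import Algebra.Definitions using (Commutative)
import Algebra.Definitions.RawMonoid as RawMonoidDefs
open import Data.List.Base using (List; []; _∷_)
import Data.List.Membership.Setoid as Membership
open import Data.Nat.Base using (ℕ; _≤_) renaming (suc to 1+_)
open import Data.Fin.Base using (Fin)
open import Data.Product.Base using (Σ-syntax; ∃-syntax; _×_; _,_; proj₁)
open import Data.Product.Relation.Binary.Pointwise.NonDependent using (×-setoid)
open import Function.Bundles using (Inverse)
open import Relation.Binary.Bundles using (Setoid)
open import Relation.Binary.Core using (Rel)
open import Relation.Binary.Definitions using (_Respects_)
import Relation.Binary.Construct.On as On
import Relation.Binary.PropositionalEquality as ≡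
open import Relation.Nullary.Negation using (¬_)
open import Relation.Unary using (Pred)

private
  variable
    c ℓ p : Level

-- Cardinalities count elements up to the setoid equality.
HasSize : Setoid c ℓ → ℕ → Set (c ⊔ ℓ)
HasSize A n = Inverse A (≡.setoid (Fin n))

-- Two elements of the restriction are equal when their first projections
-- are; the membership proofs are irrelevant.
restrict : (A : Setoid c ℓ) → Pred (Setoid.Carrier A) p → Setoid (c ⊔ p) ℓ
restrict A P = On.setoid A (proj₁ {B = P})

IsMaximum : Pred ℕ p → ℕ → Set p
IsMaximum P m = P m × (∀ n → P n → n ≤ m)

module _ (Γ : Group c ℓ) where
  open Group Γ

  HasOrder : ℕ → Set (c ⊔ ℓ)
  HasOrder = HasSize setoid

  NonAbelian : Set (c ⊔ ℓ)
  NonAbelian = ¬ Commutative _≈_ _∙_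

  record IsSubsetOfSize (S : Pred Carrier p) (s : ℕ) : Set (c ⊔ ℓ ⊔ p) where
    field
      respects : S Respects _≈_
      size     : HasSize (restrict setoid S) s

  -- x // y is x ∙ y ⁻¹.
  IsCovering : Pred Carrier p → Set (c ⊔ ℓ ⊔ p)
  IsCovering S = ∀ g → ∃[ t ] ∃[ t′ ] S t × S t′ × g ≈ t // t′

  -- g has multiplicity k in the multiset of differences of S.
  Occurs : Pred Carrier p → ℕ → Carrier → Set (c ⊔ ℓ ⊔ p)
  Occurs S k g =
    HasSize (restrict (×-setoid setoid setoid)
                      (λ (t , t′) → S t × S t′ × t // t′ ≈ g))
            k

  record IsAlmostDifferenceSet (S : Pred Carrier p) (n s λ′ t : ℕ)
         : Set (c ⊔ ℓ ⊔ p) where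
    field
      order      : HasOrder n
      subset     : IsSubsetOfSize S s
      exactly-λ  : HasSize (restrict setoid (λ g → ¬ g ≈ ε × Occurs S λ′ g)) t
      others-λ+1 : ∀ g → ¬ g ≈ ε → ¬ Occurs S λ′ g → Occurs S (1+ λ′) g

NonAbelianCoveringOrder : (c ℓ p : Level) → ℕ → Pred ℕ (suc (c ⊔ ℓ ⊔ p))
NonAbelianCoveringOrder c ℓ p s n =
  Σ[ Γ ∈ Group c ℓ ] HasOrder Γ n × NonAbelian Γ ×
  (Σ[ S ∈ Pred (Group.Carrier Γ) p ] IsSubsetOfSize Γ S s × IsCovering Γ S)

-- The group ⟨ X ∣ R ⟩: group terms over X modulo the least congruence that
-- contains R and the group axioms.
module Presentation {x r : Level} (X : Set x) where

  infixl 7 _∙_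
  infix  8 _⁻¹

  data Term : Set x where
    gen : X → Term
    ε   : Term
    _∙_ : Term → Term → Term
    _⁻¹ : Term → Term

  module _ (R : Rel Term r) where

    infix 4 _≈_

    data _≈_ : Rel Term (x ⊔ r) where
      relator   : ∀ {u v} → R u v → u ≈ v
      refl      : ∀ {u} → u ≈ u
      sym       : ∀ {u v} → u ≈ v → v ≈ u
      trans     : ∀ {u v w} → u ≈ v → v ≈ w → u ≈ w
      ∙-cong    : ∀ {u u′ v v′} → u ≈ u′ → v ≈ v′ → u ∙ v ≈ u′ ∙ v′
      ⁻¹-cong   : ∀ {u v} → u ≈ v → u ⁻¹ ≈ v ⁻¹
      assoc     : ∀ u v w → (u ∙ v) ∙ w ≈ u ∙ (v ∙ w)
      identityˡ : ∀ u → ε ∙ u ≈ u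
      identityʳ : ∀ u → u ∙ ε ≈ u
      inverseˡ  : ∀ u → u ⁻¹ ∙ u ≈ ε
      inverseʳ  : ∀ u → u ∙ u ⁻¹ ≈ ε

    isGroup : IsGroup _≈_ _∙_ ε _⁻¹
    isGroup = record
      { isMonoid = record
        { isSemigroup = record
          { isMagma = record
            { isEquivalence = record { refl = refl ; sym = sym ; trans = trans }
            ; ∙-cong = ∙-cong
            }
          ; assoc = assoc
          }
        ; identity = identityˡ , identityʳ
        }
      ; inverse = inverseˡ , inverseʳ
      ; ⁻¹-cong = ⁻¹-cong
      }

    presented : Group x (x ⊔ r)
    presented = record { isGroup = isGroup }

data Generator : Set where
  gen-a gen-b : Generator

open Presentation {r = 0ℓ} Generator using (Term; gen; ε; _∙_; _⁻¹; presented)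

private
  a b : Term
  a = gen gen-a
  b = gen gen-b

  termRawMonoid : RawMonoid 0ℓ 0ℓ
  termRawMonoid = record { Carrier = Term ; _≈_ = ≡._≡_ ; _∙_ = _∙_ ; ε = ε }

infixr 9 _^_

_^_ : Term → ℕ → Term
u ^ n = n · u
  where open RawMonoidDefs termRawMonoid using () renaming (_×_ to _·_)

data Relator : Rel Term 0ℓ where
  a⁵≈1     : Relator (a ^ 5) ε
  b⁸≈1     : Relator (b ^ 8) ε
  bab⁻¹≈a² : Relator (b ∙ a ∙ b ⁻¹) (a ^ 2)

Γ₁ : Group 0ℓ 0ℓ
Γ₁ = presented Relator

S₁ : Pred (Group.Carrier Γ₁) 0ℓ
S₁ = _∈ ε ∷ b ∷ b ^ 4 ∷ b ∙ a ∷ b ∙ a ⁻¹ ∙ b ^ 2 ∷ a ∙ b ⁻¹ ∷ b ∙ a ∙ b ^ 2 ∷ []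
  where open Membership (Group.setoid Γ₁) using (_∈_)

{-# OPTIONS --safe #-}

-- Upper bound.  The 49 quotients of S represent ε seven times, every other
-- element at least once and every involution at least twice (swap the two
-- factors), so n + 6 + #involutions ≤ 49 and n ≤ 43.  Groups of order 41 or 43
-- are commutative.  For n = 42 an involution u exists by parity, it is unique
-- by the count and hence central, and the transfer into {ε , u} is a surjective
-- homomorphism to ℤ/2.  If k of the elements of S lie in its kernel, which has
-- order 21, then 2k(7 − k) ≥ 21 and k² + (7 − k)² ≥ 7 + 20, which no k satisfies.
--
-- Attainment.  Γ₁ acts on the 40 normal forms a ^ i ∙ b ^ j, which solves its word
-- problem, so all multiplicities in the difference multiset of S₁ are computable.

module Submission where

open import Defs
open import Level using (Level; 0ℓ; Lift; lift; lower)
open import Algebra.Bundles using (CommutativeRing; Group; RawGroup)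
open import Algebra.Core using (Op₁; Op₂)
open import Algebra.Definitions using (Commutative)
import Algebra.Morphism.GroupMonomorphism
open import Algebra.Morphism.Structures using (IsGroupMonomorphism)
import Algebra.Properties.Group
import Algebra.Properties.Semiring.Sum
open import Algebra.Structures using (IsGroup)
open import Data.Bool.Base using (Bool; true; false; not; _∧_; _xor_)
open import Data.Bool.Properties
  using (∧-identityʳ; not-involutive; xor-∧-commutativeRing; xor-annihilates-not; xor-assoc;
         xor-identityʳ; xor-inverseˡ; xor-same)
open import Data.Empty using (⊥)
open import Data.Fin.Base as Fin using (Fin; zero; suc)
open import Data.Fin.Permutation using (permutation; ↔⇒≡)
import Data.Fin.Properties as Fin
import Data.List.Membership.Setoid.Properties as Membership
open import Data.List.Relation.Unary.Any as Any using (here)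
open import Data.Nat.Base as ℕ using (ℕ; zero; suc; _+_; _*_; _≤_; z≤n; s≤s)
open import Data.Nat.Divisibility using (_∣_; divides)
import Data.Nat.DivMod as ℕ
open import Data.Nat.Primality using (Prime; prime?; prime⇒irreducible)
import Data.Nat.Properties as ℕ
open import Data.Nat.Tactic.RingSolver using (solve-∀)
open import Data.Product.Base using (∃; ∃₂; ∃-syntax; _×_; _,_; proj₁; proj₂)
open import Data.Product.Properties using (≡-dec)
open import Data.Product.Relation.Binary.Pointwise.NonDependent using (×-setoid)
open import Data.Sum.Base using (_⊎_; inj₁; inj₂; [_,_]′)
open import Function.Base using (_∘_; const; id)
open import Function.Bundles using (Inverse; _↔_; mk↔ₛ′)
import Function.Properties.Inverse as Inv
open import Relation.Binary.Bundles using (Setoid)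
open import Relation.Binary.Definitions using (_Respects_; tri<; tri≈; tri>)
open import Relation.Binary.PropositionalEquality
import Relation.Binary.Reasoning.Setoid
open import Relation.Nullary using (Dec; does; yes; no; ¬_; contradiction)
open import Relation.Nullary.Decidable
  using (_×-dec_; _⊎-dec_; _→-dec_; ¬?; dec-true; dec-false; from-no; from-yes; map′)
open import Relation.Unary using (Pred; Decidable)

open import Algebra.Properties.Semiring.Sum ℕ.+-*-semiring
  using (sum; sum-cong-≗; sum-replicate-zero; ∑-comm; ∑-distrib-+; ∑-permute; *-distribˡ-sum; *-distribʳ-sum)

private
  module 𝔹 = Algebra.Properties.Semiring.Sum (CommutativeRing.semiring xor-∧-commutativeRing)

  variable
    c c′ ℓ ℓ′ p q : Level
    k m n : ℕ

-- Finite sums and counting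

𝟙 : Bool → ℕ
𝟙 false = 0
𝟙 true  = 1

⟦_⟧ : {A : Set p} → Dec A → ℕ
⟦ a? ⟧ = 𝟙 (does a?)

count : {P : Pred (Fin n) p} → Decidable P → ℕ
count P? = sum (λ x → ⟦ P? x ⟧)

⟦⟧-true : {A : Set p} (a? : Dec A) → A → ⟦ a? ⟧ ≡ 1
⟦⟧-true a? a = cong 𝟙 (dec-true a? a)

⟦⟧-false : {A : Set p} (a? : Dec A) → ¬ A → ⟦ a? ⟧ ≡ 0
⟦⟧-false a? ¬a = cong 𝟙 (dec-false a? ¬a)

⟦⟧-cong : {A : Set p} {B : Set q} (a? : Dec A) (b? : Dec B) → (A → B) → (B → A) → ⟦ a? ⟧ ≡ ⟦ b? ⟧
⟦⟧-cong (yes a) b? f g = sym (⟦⟧-true b? (f a))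
⟦⟧-cong (no ¬a) b? f g = sym (⟦⟧-false b? (¬a ∘ g))

𝟙-not : ∀ b → 𝟙 b + 𝟙 (not b) ≡ 1
𝟙-not false = refl
𝟙-not true  = refl

sum-mono : {f g : Fin n → ℕ} → (∀ i → f i ≤ g i) → sum f ≤ sum g
sum-mono {zero}  f≤g = z≤n
sum-mono {suc n} f≤g = ℕ.+-mono-≤ (f≤g zero) (sum-mono (f≤g ∘ suc))

sum-1 : ∀ n → sum {n} (const 1) ≡ n
sum-1 zero    = refl
sum-1 (suc n) = cong suc (sum-1 n)

term≤sum : (f : Fin n → ℕ) (i : Fin n) → f i ≤ sum f
term≤sum f zero    = ℕ.m≤m+n _ _
term≤sum f (suc i) = ℕ.≤-trans (term≤sum (f ∘ suc) i) (ℕ.m≤n+m _ _)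

two-terms≤sum : (f : Fin n → ℕ) {i j : Fin n} → i ≢ j → f i + f j ≤ sum f
two-terms≤sum f {zero}  {zero}  i≢j = contradiction refl i≢j
two-terms≤sum f {zero}  {suc j} i≢j = ℕ.+-monoʳ-≤ _ (term≤sum (f ∘ suc) j)
two-terms≤sum f {suc i} {zero}  i≢j =
  ℕ.≤-trans (ℕ.≤-reflexive (ℕ.+-comm _ (f zero))) (ℕ.+-monoʳ-≤ _ (term≤sum (f ∘ suc) i))
two-terms≤sum f {suc i} {suc j} i≢j =
  ℕ.≤-trans (two-terms≤sum (f ∘ suc) (i≢j ∘ cong suc)) (ℕ.m≤n+m _ _)

sum-single : (f : Fin n → ℕ) (i : Fin n) → (∀ j → j ≢ i → f j ≡ 0) → sum f ≡ f i
sum-single {suc n} f zero f≡0 = trans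
  (cong (f zero +_) (trans (sum-cong-≗ (λ j → f≡0 (suc j) λ ())) (sum-replicate-zero n)))
  (ℕ.+-identityʳ _)
sum-single f (suc i) f≡0 = trans
  (cong (_+ sum (f ∘ suc)) (f≡0 zero λ ()))
  (sum-single (f ∘ suc) i (λ j j≢i → f≡0 (suc j) (j≢i ∘ Fin.suc-injective)))

sum-weighted-point : (w : Fin n → ℕ) (x : Fin n) → sum (λ y → w y * ⟦ x Fin.≟ y ⟧) ≡ w x
sum-weighted-point w x = trans
  (sum-single _ x (λ y y≢x → trans (cong (w y *_) (⟦⟧-false (x Fin.≟ y) (y≢x ∘ sym))) (ℕ.*-zeroʳ (w y))))
  (trans (cong (w x *_) (⟦⟧-true (x Fin.≟ x) refl)) (ℕ.*-identityʳ (w x)))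

∑-bijection : (f : Fin n → ℕ) (g h : Fin n → Fin n) → (∀ x → g (h x) ≡ x) → (∀ x → h (g x) ≡ x) →
              sum (f ∘ g) ≡ sum f
∑-bijection f g h gh hg = sym (∑-permute f (permutation g h gh hg))

count-complement : (χ : Fin n → Bool) → sum (𝟙 ∘ χ) + sum (𝟙 ∘ not ∘ χ) ≡ n
count-complement χ = trans (sym (∑-distrib-+ (𝟙 ∘ χ) (𝟙 ∘ not ∘ χ))) (trans (sum-cong-≗ (𝟙-not ∘ χ)) (sum-1 _))

count-unique : {P : Pred (Fin n) p} (P? : Decidable P) (i : Fin n) → P i → (∀ j → P j → j ≡ i) → count P? ≡ 1
count-unique P? i pi unique =
  trans (sum-single _ i (λ j j≢i → ⟦⟧-false (P? j) (j≢i ∘ unique j))) (⟦⟧-true (P? i) pi)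

least : {P : Pred (Fin n) p} → Decidable P → ∃ P → ∃[ i ] P i × (∀ j → P j → i Fin.≤ j)
least {suc n} P? (i , pi) with P? zero
least {suc n} P? (i , pi)     | yes p0 = zero , p0 , λ _ _ → z≤n
least {suc n} P? (zero , pi)  | no ¬p0 = contradiction pi ¬p0
least {suc n} {P = P} P? (suc i , pi) | no ¬p0 with least (P? ∘ suc) (i , pi)
... | k , pk , k≤ = suc k , pk , λ { zero p0 → contradiction p0 ¬p0 ; (suc j) pj → s≤s (k≤ j pj) }

-- A fixed-point-free involution pairs the x < σ x with the σ x < x.
involution⇒even : {P : Pred (Fin n) p} (P? : Decidable P) (σ : Fin n → Fin n) → (∀ x → σ (σ x) ≡ x) →
                  (∀ x → P x → P (σ x)) → (∀ x → P x → x ≢ σ x) → ∃[ k ] count P? ≡ k + k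
involution⇒even {P = P} P? σ σσ P-σ x≢σx = count up? , (begin
  count P?                              ≡⟨ sum-cong-≗ split ⟩
  sum (λ x → ⟦ up? x ⟧ + ⟦ up? (σ x) ⟧) ≡⟨ ∑-distrib-+ (λ x → ⟦ up? x ⟧) (λ x → ⟦ up? (σ x) ⟧) ⟩
  count up? + sum (λ x → ⟦ up? (σ x) ⟧) ≡⟨ cong (count up? +_) (∑-bijection _ σ σ σσ σσ) ⟩
  count up? + count up?                 ∎)
  where
  open ≡-Reasoning
  up? : Decidable (λ x → P x × x Fin.< σ x)
  up? x = P? x ×-dec (x Fin.<? σ x)
  split : ∀ x → ⟦ P? x ⟧ ≡ ⟦ up? x ⟧ + ⟦ up? (σ x) ⟧
  split x with P? x
  ... | no ¬px = sym (⟦⟧-false (up? (σ x)) (¬px ∘ subst P (σσ x) ∘ P-σ (σ x) ∘ proj₁))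
  ... | yes px with Fin.<-cmp x (σ x)
  ...   | tri< x<σx _ _ = sym (cong₂ _+_ (cong 𝟙 (dec-true (x Fin.<? σ x) x<σx))
            (⟦⟧-false (up? (σ x)) (λ (_ , σx<σσx) → Fin.<-asym x<σx (subst (σ x Fin.<_) (σσ x) σx<σσx))))
  ...   | tri≈ _ x≡σx _ = contradiction x≡σx (x≢σx x px)
  ...   | tri> ¬x<σx _ σx<x = sym (cong₂ _+_ (cong 𝟙 (dec-false (x Fin.<? σ x) ¬x<σx))
            (⟦⟧-true (up? (σ x)) (P-σ x px , subst (σ x Fin.<_) (sym (σσ x)) σx<x)))

-- `χ` selects exactly one point of each orbit {x , σ x}, so `f` is the sum of `g` and `g ∘ σ`,
-- where `g` is `f` cut down to the selected points. These two have equal totals, which cancel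
-- modulo 2.
xor-involution : (f : Fin n → Bool) (σ : Fin n → Fin n) → (∀ x → σ (σ x) ≡ x) →
                 (χ : Fin n → Bool) → (∀ x → χ (σ x) ≡ not (χ x)) →
                 (∀ x → f (σ x) ≡ f x) → 𝔹.sum f ≡ false
xor-involution f σ σσ χ χ-σ f-σ = begin
  𝔹.sum f                                      ≡⟨ 𝔹.sum-cong-≗ split ⟩
  𝔹.sum (λ x → g x xor g (σ x))                ≡⟨ 𝔹.∑-distrib-+ g (g ∘ σ) ⟩
  𝔹.sum g xor 𝔹.sum (g ∘ σ)                    ≡⟨ cong (𝔹.sum g xor_) (𝔹.∑-permute g (permutation σ σ σσ σσ)) ⟨
  𝔹.sum g xor 𝔹.sum g                          ≡⟨ xor-same (𝔹.sum g) ⟩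
  false                                        ∎
  where
  open ≡-Reasoning
  g : Fin _ → Bool
  g x = χ x ∧ f x
  split : ∀ x → f x ≡ g x xor g (σ x)
  split x rewrite χ-σ x | f-σ x with χ x
  ... | true  = sym (xor-identityʳ (f x))
  ... | false = refl

odd : ℕ → Bool
odd zero    = false
odd (suc n) = not (odd n)

xor-sum≡odd-sum : (χ : Fin n → Bool) → 𝔹.sum χ ≡ odd (sum (𝟙 ∘ χ))
xor-sum≡odd-sum {zero}  χ = refl
xor-sum≡odd-sum {suc n} χ with χ zero
... | true  = cong not (xor-sum≡odd-sum (χ ∘ suc))
... | false = xor-sum≡odd-sum (χ ∘ suc)

⟦⟧-× : {A : Set p} {B : Set q} (a? : Dec A) (b? : Dec B) → ⟦ a? ×-dec b? ⟧ ≡ ⟦ a? ⟧ * ⟦ b? ⟧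
⟦⟧-× (no _)  _  = refl
⟦⟧-× (yes _) b? = sym (ℕ.+-identityʳ ⟦ b? ⟧)

-- A failing `x` would add at least 1 to the count of the complement, and the two counts together
-- would exceed `n`.
count-all : {P : Pred (Fin n) p} (P? : Decidable P) → count P? ≡ n → ∀ x → P x
count-all {n = n} P? count≡n x with P? x in eq
... | yes px = px
... | no ¬px = contradiction n+1≤n ℕ.1+n≰n
  where
  open ℕ.≤-Reasoning
  n+1≤n : suc n ≤ n
  n+1≤n = begin
    suc n                          ≡⟨ ℕ.+-comm 1 n ⟩
    n + 1                          ≡⟨ cong₂ _+_ count≡n (⟦⟧-true (¬? (P? x)) ¬px) ⟨
    count P? + ⟦ ¬? (P? x) ⟧       ≤⟨ ℕ.+-monoʳ-≤ (count P?) (term≤sum (λ y → ⟦ ¬? (P? y) ⟧) x) ⟩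
    count P? + count (¬? ∘ P?)     ≡⟨ count-complement (does ∘ P?) ⟩
    n                              ∎

double-injective : ∀ m n → m + m ≡ n + n → m ≡ n
double-injective zero    zero    _  = refl
double-injective (suc m) (suc n) eq = cong suc (double-injective m n (ℕ.suc-injective
  (trans (sym (ℕ.+-suc m m)) (trans (ℕ.suc-injective eq) (ℕ.+-suc n n)))))

-- The bijection `g` exchanges the points where `χ` is true with those where it is false.
flip⇒half : (χ : Fin n → Bool) (g h : Fin n → Fin n) → (∀ x → g (h x) ≡ x) → (∀ x → h (g x) ≡ x) →
            (∀ x → χ (g x) ≡ not (χ x)) → sum (𝟙 ∘ χ) + sum (𝟙 ∘ χ) ≡ n
flip⇒half χ g h gh hg χ-g = trans
  (cong (sum (𝟙 ∘ χ) +_) (trans (sym (∑-bijection (𝟙 ∘ χ) g h gh hg)) (sum-cong-≗ (cong 𝟙 ∘ χ-g))))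
  (count-complement χ)

sum-product : (f : Fin m → ℕ) (g : Fin n → ℕ) → sum (λ i → sum (λ j → f i * g j)) ≡ sum f * sum g
sum-product f g = trans (sum-cong-≗ (λ i → sym (*-distribˡ-sum (f i) g))) (sym (*-distribʳ-sum (sum g) f))

-- An ordered pair is counted when `v` separates its entries; the two orders contribute `a * b` and
-- `b * a`.
sum-xor : (v : Fin n → Bool) → let a = sum (𝟙 ∘ v) ; b = sum (𝟙 ∘ not ∘ v) in
          sum (λ i → sum (λ j → 𝟙 (v i xor v j))) ≡ a * b + b * a
sum-xor v = begin
  sum (λ i → sum (λ j → 𝟙 (v i xor v j)))
    ≡⟨ sum-cong-≗ (λ i → trans (sum-cong-≗ (λ j → 𝟙-xor (v i) (v j)))
                               (∑-distrib-+ (λ j → 𝟙 (v i) * 𝟙 (not (v j))) (λ j → 𝟙 (not (v i)) * 𝟙 (v j)))) ⟩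
  sum (λ i → sum (λ j → 𝟙 (v i) * 𝟙 (not (v j))) + sum (λ j → 𝟙 (not (v i)) * 𝟙 (v j)))
    ≡⟨ ∑-distrib-+ (λ i → sum (λ j → 𝟙 (v i) * 𝟙 (not (v j)))) (λ i → sum (λ j → 𝟙 (not (v i)) * 𝟙 (v j))) ⟩
  sum (λ i → sum (λ j → 𝟙 (v i) * 𝟙 (not (v j)))) + sum (λ i → sum (λ j → 𝟙 (not (v i)) * 𝟙 (v j)))
    ≡⟨ cong₂ _+_ (sum-product (𝟙 ∘ v) (𝟙 ∘ not ∘ v)) (sum-product (𝟙 ∘ not ∘ v) (𝟙 ∘ v)) ⟩
  sum (𝟙 ∘ v) * sum (𝟙 ∘ not ∘ v) + sum (𝟙 ∘ not ∘ v) * sum (𝟙 ∘ v) ∎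
  where
  open ≡-Reasoning
  𝟙-xor : ∀ a b → 𝟙 (a xor b) ≡ 𝟙 a * 𝟙 (not b) + 𝟙 (not a) * 𝟙 b
  𝟙-xor false false = refl
  𝟙-xor false true  = refl
  𝟙-xor true  false = refl
  𝟙-xor true  true  = refl

-- Groups with carrier Fin n

module FiniteGroup {n : ℕ} {_∙_ : Op₂ (Fin n)} {ε : Fin n} {_⁻¹ : Op₁ (Fin n)}
                   (isGroup : IsGroup _≡_ _∙_ ε _⁻¹) where

  private
    group : Group 0ℓ 0ℓ
    group = record { isGroup = isGroup }

  open Group group using (assoc; identityˡ; identityʳ; inverseˡ; inverseʳ; _//_; _\\_)
  open Algebra.Properties.Group group

  ∑-translateˡ : ∀ g (f : Fin n → ℕ) → sum (λ x → f (g ∙ x)) ≡ sum f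
  ∑-translateˡ g f = ∑-bijection f (g ∙_) (g \\_) (\\-leftDividesˡ g) (\\-leftDividesʳ g)

  ∑-translateʳ : ∀ g (f : Fin n → ℕ) → sum (λ x → f (x ∙ g)) ≡ sum f
  ∑-translateʳ g f = ∑-bijection f (_∙ g) (_// g) (//-rightDividesˡ g) (//-rightDividesʳ g)

  -- Every left coset of H has exactly one representative, namely its least
  -- element, and the translates of H cover every representative |H| times.
  lagrange : {H : Pred (Fin n) p} (H? : Decidable H) → H ε →
             (∀ {x y} → H x → H y → H (x ∙ y)) → (∀ {x} → H x → H (x ⁻¹)) → count H? ∣ n
  lagrange {H = H} H? H-ε H-∙ H-⁻¹ = divides (count rep?) (begin
    n
      ≡⟨ sum-1 n ⟨
    sum {n} (const 1)
      ≡⟨ sum-cong-≗ (sym ∘ unique-rep) ⟩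
    sum (λ y → sum (λ z → ⟦ H? (y \\ z) ⟧ * ⟦ rep? z ⟧))
      ≡⟨ sum-cong-≗ (λ y → sum-cong-≗ (λ z → cong (λ t → ⟦ H? (y \\ z) ⟧ * ⟦ rep? t ⟧) (sym (\\-leftDividesˡ y z)))) ⟩
    sum (λ y → sum (λ z → ⟦ H? (y \\ z) ⟧ * ⟦ rep? (y ∙ (y \\ z)) ⟧))
      ≡⟨ sum-cong-≗ (λ y → ∑-translateˡ (y ⁻¹) (λ h → ⟦ H? h ⟧ * ⟦ rep? (y ∙ h) ⟧)) ⟩
    sum (λ y → sum (λ h → ⟦ H? h ⟧ * ⟦ rep? (y ∙ h) ⟧))
      ≡⟨ ∑-comm (λ y h → ⟦ H? h ⟧ * ⟦ rep? (y ∙ h) ⟧) ⟩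
    sum (λ h → sum (λ y → ⟦ H? h ⟧ * ⟦ rep? (y ∙ h) ⟧))
      ≡⟨ sum-cong-≗ (λ h → ∑-translateʳ h (λ y → ⟦ H? h ⟧ * ⟦ rep? y ⟧)) ⟩
    sum (λ h → sum (λ y → ⟦ H? h ⟧ * ⟦ rep? y ⟧))
      ≡⟨ sum-product (λ h → ⟦ H? h ⟧) (λ y → ⟦ rep? y ⟧) ⟩
    count H? * count rep?
      ≡⟨ ℕ.*-comm (count H?) (count rep?) ⟩
    count rep? * count H? ∎)
    where
    open ≡-Reasoning
    Rep : Pred (Fin n) _
    Rep z = ∀ w → H (z \\ w) → z Fin.≤ w
    rep? : Decidable Rep
    rep? z = Fin.all? (λ w → H? (z \\ w) →-dec (z Fin.≤? w))
    ~-sym : ∀ {x y} → H (x \\ y) → H (y \\ x)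
    ~-sym {x} {y} h = subst H (⁻¹-anti-homo-\\ x y) (H-⁻¹ h)
    ~-trans : ∀ {x y z} → H (x \\ y) → H (y \\ z) → H (x \\ z)
    ~-trans {x} {y} {z} h k = subst H (trans (assoc (x ⁻¹) y (y \\ z)) (cong ((x ⁻¹) ∙_) (\\-leftDividesˡ y z))) (H-∙ h k)
    unique-rep : ∀ y → sum (λ z → ⟦ H? (y \\ z) ⟧ * ⟦ rep? z ⟧) ≡ 1
    unique-rep y with least (λ z → H? (y \\ z)) (y , subst H (sym (inverseˡ y)) H-ε)
    ... | z₀ , y~z₀ , z₀≤ = trans
      (sum-cong-≗ (λ z → sym (⟦⟧-× (H? (y \\ z)) (rep? z))))
      (count-unique (λ z → H? (y \\ z) ×-dec rep? z) z₀ (y~z₀ , λ w z₀~w → z₀≤ w (~-trans y~z₀ z₀~w))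
        (λ z (y~z , z≤) → Fin.≤-antisym (z≤ z₀ (~-trans (~-sym y~z) y~z₀)) (z₀≤ z y~z)))

  -- The centraliser of x ≠ ε has at least the two elements ε and x.
  prime⇒commutative : Prime n → Commutative _≡_ _∙_
  prime⇒commutative n-prime x y with x Fin.≟ ε
  ... | yes refl = trans (identityˡ y) (sym (identityʳ y))
  ... | no x≢ε = count-all C? (count≡n (prime⇒irreducible n-prime
                   (lagrange C? (trans (identityʳ x) (sym (identityˡ x))) C-∙ C-⁻¹))) y
    where
    C? : Decidable (λ z → x ∙ z ≡ z ∙ x)
    C? z = (x ∙ z) Fin.≟ (z ∙ x)
    C-∙ : ∀ {z w} → x ∙ z ≡ z ∙ x → x ∙ w ≡ w ∙ x → x ∙ (z ∙ w) ≡ (z ∙ w) ∙ x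
    C-∙ {z} {w} cz cw = trans (sym (assoc x z w)) (trans (cong (_∙ w) cz)
                          (trans (assoc z x w) (trans (cong (z ∙_) cw) (sym (assoc z w x)))))
    C-⁻¹ : ∀ {z} → x ∙ z ≡ z ∙ x → x ∙ (z ⁻¹) ≡ (z ⁻¹) ∙ x
    C-⁻¹ {z} cz = trans (sym (\\-leftDividesʳ z _)) (cong ((z ⁻¹) ∙_)
                    (trans (sym (assoc z x (z ⁻¹))) (trans (cong (_∙ (z ⁻¹)) (sym cz)) (//-rightDividesʳ z x))))
    count≥2 : 2 ≤ count C?
    count≥2 = ℕ.≤-trans
      (ℕ.≤-reflexive (sym (cong₂ _+_ (⟦⟧-true (C? x) refl)
                                     (⟦⟧-true (C? ε) (trans (identityʳ x) (sym (identityˡ x)))))))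
      (two-terms≤sum (λ z → ⟦ C? z ⟧) x≢ε)
    count≡n : count C? ≡ 1 ⊎ count C? ≡ n → count C? ≡ n
    count≡n (inj₁ ≡1) = contradiction (subst (2 ≤_) ≡1 count≥2) λ { (s≤s ()) }
    count≡n (inj₂ ≡n) = ≡n

  IsInvolution : Pred (Fin n) 0ℓ
  IsInvolution g = g ≢ ε × g ∙ g ≡ ε

  isInvolution? : Decidable IsInvolution
  isInvolution? g = ¬? (g Fin.≟ ε) ×-dec ((g ∙ g) Fin.≟ ε)

  -- Inversion pairs off the elements that differ from their inverses. Without involutions only `ε`
  -- is left over, and `n` would be odd.
  even⇒∃involution : n ≡ k + k → ∃ IsInvolution
  even⇒∃involution {k} n≡k+k with Fin.any? isInvolution?
  ... | yes ∃u = ∃u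
  ... | no ¬∃u = contradiction (begin
    true                                    ≡⟨ cong not (odd-double (proj₁ pairs)) ⟨
    odd (suc (proj₁ pairs + proj₁ pairs))   ≡⟨ cong (odd ∘ suc) (proj₂ pairs) ⟨
    odd (suc (count (¬? ∘ self?)))          ≡⟨ cong (λ t → odd (t + count (¬? ∘ self?)))
                                                    (count-unique self? ε (sym ε⁻¹≈ε) only-ε) ⟨
    odd (count self? + count (¬? ∘ self?))  ≡⟨ cong odd (count-complement (does ∘ self?)) ⟩
    odd n                                   ≡⟨ cong odd n≡k+k ⟩
    odd (k + k)                             ≡⟨ odd-double k ⟩
    false                                   ∎) λ ()
    where
    open ≡-Reasoning
    odd-double : ∀ j → odd (j + j) ≡ false
    odd-double zero    = refl
    odd-double (suc j) = trans (cong (not ∘ odd) (ℕ.+-suc j j)) (trans (not-involutive _) (odd-double j))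
    self? : Decidable (λ x → x ≡ x ⁻¹)
    self? x = x Fin.≟ x ⁻¹
    pairs : ∃[ j ] count (¬? ∘ self?) ≡ j + j
    pairs = involution⇒even (¬? ∘ self?) _⁻¹ ⁻¹-involutive (λ x x≢ x⁻¹≡ → x≢ (⁻¹-injective x⁻¹≡)) (λ x x≢ → x≢)
    only-ε : ∀ x → x ≡ x ⁻¹ → x ≡ ε
    only-ε x x≡x⁻¹ with x Fin.≟ ε
    ... | yes x≡ε = x≡ε
    ... | no x≢ε  = contradiction (x , x≢ε , trans (cong (x ∙_) x≡x⁻¹) (inverseʳ x)) ¬∃u

  -- Multiplicities of quotients of a covering family with r + 1 members

  module Covering {r : ℕ} (s : Fin (suc r) → Fin n) (cover : ∀ g → ∃₂ λ i j → g ≡ s i // s j) where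

    multiplicity : Fin n → ℕ
    multiplicity g = sum (λ i → sum (λ j → ⟦ (s i // s j) Fin.≟ g ⟧))

    -- The r + 1 diagonal pairs all represent `ε`, any other element has the pair given by `cover`,
    -- and an involution has that pair and its swap. Since `ε` is not an involution, the two extra
    -- terms never occur together.
    multiplicity-lower : ∀ g → 1 + ⟦ ε Fin.≟ g ⟧ * r + ⟦ isInvolution? g ⟧ ≤ multiplicity g
    multiplicity-lower g with cover g
    ... | i , j , g≡ = by-cases (ε Fin.≟ g) (isInvolution? g)
      where
      by-cases : (e? : Dec (ε ≡ g)) (v? : Dec (IsInvolution g)) → 1 + ⟦ e? ⟧ * r + ⟦ v? ⟧ ≤ multiplicity g
      by-cases (yes refl) v? = begin
        1 + 1 * r + ⟦ v? ⟧
          ≡⟨ cong₂ (λ x y → suc x + y) (ℕ.*-identityˡ r) (⟦⟧-false v? (λ (ε≢ε , _) → ε≢ε refl)) ⟩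
        suc r + 0
          ≡⟨ ℕ.+-identityʳ (suc r) ⟩
        suc r
          ≡⟨ sum-1 (suc r) ⟨
        sum {suc r} (const 1)
          ≤⟨ sum-mono (λ i → ℕ.≤-trans (ℕ.≤-reflexive (sym (⟦⟧-true ((s i // s i) Fin.≟ ε) (inverseʳ (s i)))))
                                       (term≤sum (λ j → ⟦ (s i // s j) Fin.≟ ε ⟧) i)) ⟩
        multiplicity ε ∎
        where open ℕ.≤-Reasoning
      by-cases (no ε≢g) (no _) = begin
        1                               ≡⟨ ⟦⟧-true ((s i // s j) Fin.≟ g) (sym g≡) ⟨
        ⟦ (s i // s j) Fin.≟ g ⟧        ≤⟨ term≤sum (λ j → ⟦ (s i // s j) Fin.≟ g ⟧) j ⟩
        sum (λ j → ⟦ (s i // s j) Fin.≟ g ⟧) ≤⟨ term≤sum (λ i → sum (λ j → ⟦ (s i // s j) Fin.≟ g ⟧)) i ⟩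
        multiplicity g                  ∎
        where open ℕ.≤-Reasoning
      -- Both (i , j) and (j , i) represent the involution g.
      by-cases (no ε≢g) (yes (_ , gg≡ε)) = begin
        2
          ≡⟨ cong₂ _+_ (⟦⟧-true ((s i // s j) Fin.≟ g) (sym g≡)) (⟦⟧-true ((s j // s i) Fin.≟ g) sⱼ//sᵢ≡g) ⟨
        ⟦ (s i // s j) Fin.≟ g ⟧ + ⟦ (s j // s i) Fin.≟ g ⟧
          ≤⟨ ℕ.+-mono-≤ (term≤sum (λ j → ⟦ (s i // s j) Fin.≟ g ⟧) j) (term≤sum (λ i → ⟦ (s j // s i) Fin.≟ g ⟧) i) ⟩
        sum (λ k → ⟦ (s i // s k) Fin.≟ g ⟧) + sum (λ k → ⟦ (s j // s k) Fin.≟ g ⟧)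
          ≤⟨ two-terms≤sum (λ i → sum (λ j → ⟦ (s i // s j) Fin.≟ g ⟧)) i≢j ⟩
        multiplicity g ∎
        where
        open ℕ.≤-Reasoning
        i≢j : i ≢ j
        i≢j refl = ε≢g (sym (trans g≡ (inverseʳ (s i))))
        sⱼ//sᵢ≡g : s j // s i ≡ g
        sⱼ//sᵢ≡g = trans (sym (⁻¹-anti-homo-// (s i) (s j))) (trans (cong _⁻¹ (sym g≡)) (sym (inverseʳ-unique g g gg≡ε)))

    -- Double counting: after exchanging the sums, a pair (i , j) meets only the single element g =
    -- `s i // s j`.
    sum-multiplicity : (w : Fin n → ℕ) → sum (λ g → w g * multiplicity g) ≡ sum (λ i → sum (λ j → w (s i // s j)))
    sum-multiplicity w = begin
      sum (λ g → w g * multiplicity g)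
        ≡⟨ sum-cong-≗ (λ g → trans (*-distribˡ-sum (w g) (λ i → sum (λ j → ⟦ (s i // s j) Fin.≟ g ⟧)))
                                    (sum-cong-≗ (λ i → *-distribˡ-sum (w g) (λ j → ⟦ (s i // s j) Fin.≟ g ⟧)))) ⟩
      sum (λ g → sum (λ i → sum (λ j → w g * ⟦ (s i // s j) Fin.≟ g ⟧)))
        ≡⟨ ∑-comm (λ g i → sum (λ j → w g * ⟦ (s i // s j) Fin.≟ g ⟧)) ⟩
      sum (λ i → sum (λ g → sum (λ j → w g * ⟦ (s i // s j) Fin.≟ g ⟧)))
        ≡⟨ sum-cong-≗ (λ i → ∑-comm (λ g j → w g * ⟦ (s i // s j) Fin.≟ g ⟧)) ⟩
      sum (λ i → sum (λ j → sum (λ g → w g * ⟦ (s i // s j) Fin.≟ g ⟧)))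
        ≡⟨ sum-cong-≗ (λ i → sum-cong-≗ (λ j → sum-weighted-point w (s i // s j))) ⟩
      sum (λ i → sum (λ j → w (s i // s j))) ∎
      where open ≡-Reasoning

    -- Sums `multiplicity-lower` against the weight `w`. The constant weight bounds the order of the
    -- group; the indicators of the kernel of a homomorphism to ℤ/2 and of its complement handle
    -- order 42.
    weighted-bound : (w : Fin n → ℕ) →
                     sum w + w ε * r + sum (λ g → w g * ⟦ isInvolution? g ⟧) ≤ sum (λ i → sum (λ j → w (s i // s j)))
    weighted-bound w = begin
      sum w + w ε * r + sum (λ g → w g * ⟦ isInvolution? g ⟧)
        ≡⟨ cong (λ t → sum w + t * r + sum (λ g → w g * ⟦ isInvolution? g ⟧)) (sum-weighted-point w ε) ⟨
      sum w + sum (λ g → w g * ⟦ ε Fin.≟ g ⟧) * r + sum (λ g → w g * ⟦ isInvolution? g ⟧)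
        ≡⟨ cong (λ t → sum w + t + sum (λ g → w g * ⟦ isInvolution? g ⟧)) (*-distribʳ-sum r (λ g → w g * ⟦ ε Fin.≟ g ⟧)) ⟩
      sum w + sum (λ g → w g * ⟦ ε Fin.≟ g ⟧ * r) + sum (λ g → w g * ⟦ isInvolution? g ⟧)
        ≡⟨ cong (_+ sum (λ g → w g * ⟦ isInvolution? g ⟧)) (∑-distrib-+ w (λ g → w g * ⟦ ε Fin.≟ g ⟧ * r)) ⟨
      sum (λ g → w g + w g * ⟦ ε Fin.≟ g ⟧ * r) + sum (λ g → w g * ⟦ isInvolution? g ⟧)
        ≡⟨ ∑-distrib-+ (λ g → w g + w g * ⟦ ε Fin.≟ g ⟧ * r) (λ g → w g * ⟦ isInvolution? g ⟧) ⟨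
      sum (λ g → w g + w g * ⟦ ε Fin.≟ g ⟧ * r + w g * ⟦ isInvolution? g ⟧)
        ≡⟨ sum-cong-≗ (λ g → factor (w g) ⟦ ε Fin.≟ g ⟧ r ⟦ isInvolution? g ⟧) ⟩
      sum (λ g → w g * (1 + ⟦ ε Fin.≟ g ⟧ * r + ⟦ isInvolution? g ⟧))
        ≤⟨ sum-mono (λ g → ℕ.*-monoʳ-≤ (w g) (multiplicity-lower g)) ⟩
      sum (λ g → w g * multiplicity g)
        ≡⟨ sum-multiplicity w ⟩
      sum (λ i → sum (λ j → w (s i // s j))) ∎
      where
      open ℕ.≤-Reasoning
      factor : ∀ a b c d → a + a * b * c + a * d ≡ a * (1 + b * c + d)
      factor = solve-∀

    order+involutions-bound : n + r + count isInvolution? ≤ suc r * suc r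
    order+involutions-bound = begin
      n + r + count isInvolution?
        ≡⟨ cong₂ _+_ (cong₂ _+_ (sum-1 n) (ℕ.*-identityˡ r))
                     (sum-cong-≗ (λ g → ℕ.*-identityˡ ⟦ isInvolution? g ⟧)) ⟨
      sum {n} (const 1) + 1 * r + sum (λ g → 1 * ⟦ isInvolution? g ⟧)
        ≤⟨ weighted-bound (const 1) ⟩
      sum {suc r} (λ i → sum {suc r} (λ j → 1))
        ≡⟨ sum-product {suc r} {suc r} (const 1) (const 1) ⟩
      sum {suc r} (const 1) * sum {suc r} (const 1)
        ≡⟨ cong₂ _*_ (sum-1 (suc r)) (sum-1 (suc r)) ⟩
      suc r * suc r ∎
      where open ℕ.≤-Reasoning

  -- The transfer into the subgroup {ε , u} of order two: χ selects one element
  -- of each coset {x , x ∙ u}, and φ g is the parity of the number of cosets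
  -- whose selected element is not carried to a selected one by g.
  module Transfer (u : Fin n) (u-involution : IsInvolution u) where

    private
      xuu≡x : ∀ x → (x ∙ u) ∙ u ≡ x
      xuu≡x x = trans (assoc x u u) (trans (cong (x ∙_) (proj₂ u-involution)) (identityʳ x))

      x≢xu : ∀ x → x ≢ x ∙ u
      x≢xu x x≡xu = proj₁ u-involution (sym (∙-cancelˡ x ε u (trans (identityʳ x) x≡xu)))

    χ : Fin n → Bool
    χ x = does (x Fin.<? (x ∙ u))

    χ-flip : ∀ x → χ (x ∙ u) ≡ not (χ x)
    χ-flip x rewrite xuu≡x x with Fin.<-cmp x (x ∙ u)
    ... | tri< a _ c = trans (dec-false ((x ∙ u) Fin.<? x) c) (cong not (sym (dec-true (x Fin.<? (x ∙ u)) a)))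
    ... | tri≈ _ b _ = contradiction b (x≢xu x)
    ... | tri> a _ c = trans (dec-true ((x ∙ u) Fin.<? x) c) (cong not (sym (dec-false (x Fin.<? (x ∙ u)) a)))

    change : Fin n → Fin n → Bool
    change g x = χ (g ∙ x) xor χ x

    change-invariant : ∀ g x → change g (x ∙ u) ≡ change g x
    change-invariant g x = trans
      (cong₂ _xor_ (trans (cong χ (sym (assoc g x u))) (χ-flip (g ∙ x))) (χ-flip x))
      (xor-annihilates-not (χ (g ∙ x)) (χ x))

    φ : Fin n → Bool
    φ g = 𝔹.sum (λ x → χ x ∧ change g x)

    -- The obstruction change h x ∧ change g (h ∙ x) to additivity takes the same
    -- value at x and x ∙ u, so its sum vanishes.
    φ-∙ : ∀ g h → φ (g ∙ h) ≡ φ g xor φ h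
    φ-∙ g h = begin
      φ (g ∙ h)
        ≡⟨ 𝔹.sum-cong-≗ (λ x → trans (cong (λ t → χ x ∧ (χ t xor χ x)) (assoc g h x))
                                      (cocycle (χ (g ∙ (h ∙ x))) (χ (h ∙ x)) (χ x))) ⟩
      𝔹.sum (λ x → (χ (h ∙ x) ∧ change g (h ∙ x)) xor ((χ x ∧ change h x) xor (change h x ∧ change g (h ∙ x))))
        ≡⟨ 𝔹.∑-distrib-+ (λ x → χ (h ∙ x) ∧ change g (h ∙ x)) (λ x → (χ x ∧ change h x) xor (change h x ∧ change g (h ∙ x))) ⟩
      𝔹.sum (λ x → χ (h ∙ x) ∧ change g (h ∙ x)) xor 𝔹.sum (λ x → (χ x ∧ change h x) xor (change h x ∧ change g (h ∙ x)))
        ≡⟨ cong₂ _xor_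
             (sym (𝔹.∑-permute (λ x → χ x ∧ change g x) (permutation (h ∙_) (h \\_) (\\-leftDividesˡ h) (\\-leftDividesʳ h))))
             (𝔹.∑-distrib-+ (λ x → χ x ∧ change h x) (λ x → change h x ∧ change g (h ∙ x))) ⟩
      φ g xor (φ h xor 𝔹.sum (λ x → change h x ∧ change g (h ∙ x)))
        ≡⟨ cong (λ t → φ g xor (φ h xor t)) (xor-involution (λ x → change h x ∧ change g (h ∙ x)) (_∙ u) xuu≡x χ χ-flip
             (λ x → cong₂ _∧_ (change-invariant h x) (trans (cong (change g) (sym (assoc h x u))) (change-invariant g (h ∙ x))))) ⟩
      φ g xor (φ h xor false)
        ≡⟨ cong (φ g xor_) (xor-identityʳ (φ h)) ⟩
      φ g xor φ h ∎
      where
      open ≡-Reasoning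
      -- Over the field with two elements, c(a + c) = c(a + b) + c(b + c), and c = b + (b + c)
      -- splits the first summand further.
      cocycle : ∀ a b c → c ∧ (a xor c) ≡ (b ∧ (a xor b)) xor ((c ∧ (b xor c)) xor ((b xor c) ∧ (a xor b)))
      cocycle false false false = refl
      cocycle false false true  = refl
      cocycle false true  false = refl
      cocycle false true  true  = refl
      cocycle true  false false = refl
      cocycle true  false true  = refl
      cocycle true  true  false = refl
      cocycle true  true  true  = refl

    φ-ε : φ ε ≡ false
    φ-ε = xor-idem-false (φ ε) (trans (cong φ (sym (identityˡ ε))) (φ-∙ ε ε))
      where
      xor-idem-false : ∀ b → b ≡ b xor b → b ≡ false
      xor-idem-false false _ = refl

    -- In ℤ/2 every element is its own inverse, so `φ y` can be moved across the equation for
    -- `(x // y) ∙ y`.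
    φ-// : ∀ x y → φ (x // y) ≡ φ x xor φ y
    φ-// x y = begin
      φ (x // y)                    ≡⟨ xor-identityʳ _ ⟨
      φ (x // y) xor false          ≡⟨ cong (φ (x // y) xor_) (xor-same (φ y)) ⟨
      φ (x // y) xor (φ y xor φ y)  ≡⟨ xor-assoc (φ (x // y)) (φ y) (φ y) ⟨
      (φ (x // y) xor φ y) xor φ y  ≡⟨ cong (_xor φ y) (φ-∙ (x // y) y) ⟨
      φ ((x // y) ∙ y) xor φ y      ≡⟨ cong (λ t → φ t xor φ y) (//-rightDividesˡ y x) ⟩
      φ x xor φ y                   ∎
      where open ≡-Reasoning

    -- Left multiplication by a central `u` swaps the two elements of every coset {x , x ∙ u}, so
    -- each of the `k` cosets contributes 1.
    φ-central : (∀ x → u ∙ x ≡ x ∙ u) → n ≡ k + k → φ u ≡ odd k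
    φ-central {k} u-central n≡k+k = begin
      φ u                     ≡⟨ 𝔹.sum-cong-≗ (λ x → trans (cong (χ x ∧_) (changes x)) (∧-identityʳ (χ x))) ⟩
      𝔹.sum χ                 ≡⟨ xor-sum≡odd-sum χ ⟩
      odd (sum (𝟙 ∘ χ))       ≡⟨ cong odd (double-injective (sum (𝟙 ∘ χ)) k
                               (trans (flip⇒half χ (_∙ u) (_∙ u) xuu≡x xuu≡x χ-flip) n≡k+k)) ⟩
      odd k                   ∎
      where
      open ≡-Reasoning
      changes : ∀ x → change u x ≡ true
      changes x = trans (cong (_xor χ x) (trans (cong χ (u-central x)) (χ-flip x))) (xor-inverseˡ (χ x))

    -- Left multiplication by `u` exchanges the kernel of `φ` with its complement.
    φ-kernel : φ u ≡ true → sum (𝟙 ∘ φ) + sum (𝟙 ∘ φ) ≡ n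
    φ-kernel φu = flip⇒half φ (u ∙_) (u \\_) (\\-leftDividesˡ u) (\\-leftDividesʳ u)
                    (λ x → trans (φ-∙ u x) (cong (_xor φ x) φu))

-- x and y count the pairs of elements of S on which φ differs and agrees.
no-split-of-seven : ∀ a {b x y} → a + b ≡ 7 → x ≡ a * b + b * a → x + y ≡ 49 → 21 ≤ x → 27 ≤ y → ⊥
no-split-of-seven 0 refl refl refl 21≤x _    = from-no (21 ℕ.≤? 0) 21≤x
no-split-of-seven 1 refl refl refl 21≤x _    = from-no (21 ℕ.≤? 12) 21≤x
no-split-of-seven 2 refl refl refl 21≤x _    = from-no (21 ℕ.≤? 20) 21≤x
no-split-of-seven 3 refl refl refl _    27≤y = from-no (27 ℕ.≤? 25) 27≤y
no-split-of-seven 4 refl refl refl _    27≤y = from-no (27 ℕ.≤? 25) 27≤y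
no-split-of-seven 5 refl refl refl 21≤x _    = from-no (21 ℕ.≤? 20) 21≤x
no-split-of-seven 6 refl refl refl 21≤x _    = from-no (21 ℕ.≤? 12) 21≤x
no-split-of-seven 7 refl refl refl 21≤x _    = from-no (21 ℕ.≤? 0) 21≤x

-- Orders of non-Abelian groups covered by seven elements

module _ {n : ℕ} {_∙_ : Op₂ (Fin n)} {ε : Fin n} {_⁻¹ : Op₁ (Fin n)}
         (isGroup : IsGroup _≡_ _∙_ ε _⁻¹) where

  private
    group : Group 0ℓ 0ℓ
    group = record { isGroup = isGroup }

  open Group group using (assoc; identityˡ; identityʳ; inverseˡ; _//_; _\\_)
  open Algebra.Properties.Group group
  open FiniteGroup isGroup

  module _ (s : Fin 7 → Fin n) (cover : ∀ g → ∃₂ λ i j → g ≡ s i // s j) where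

    open Covering s cover

    covering⇒order≢42 : n ≢ 42
    covering⇒order≢42 refl = no-split-of-seven (sum (𝟙 ∘ φ ∘ s)) (count-complement (φ ∘ s))
      -- By `φ-//`, a quotient lies outside the kernel exactly when `φ` differs on its two factors.
      (trans (sum-cong-≗ (λ i → sum-cong-≗ (λ j → cong 𝟙 (φ-// (s i) (s j))))) (sum-xor (φ ∘ s)))
      (trans (sym (∑-distrib-+ (λ i → sum (λ j → 𝟙 (φ (s i // s j)))) (λ i → sum (λ j → 𝟙 (not (φ (s i // s j)))))))
        (sum-cong-≗ (λ i → count-complement (λ j → φ (s i // s j)))))
      outside inside
      where
      open ≡-Reasoning
      count≤1 : count isInvolution? ≤ 1
      -- Here 48 = 42 + 6, out of the 49 pairs.
      count≤1 = ℕ.+-cancelˡ-≤ 48 _ _ order+involutions-bound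
      u : Fin n
      u = proj₁ (even⇒∃involution {21} refl)
      u-inv : IsInvolution u
      u-inv = proj₂ (even⇒∃involution {21} refl)
      unique : ∀ {v} → IsInvolution v → v ≡ u
      unique {v} v-inv with v Fin.≟ u
      ... | yes v≡u = v≡u
      ... | no v≢u  = contradiction (ℕ.≤-trans
        (ℕ.≤-reflexive (sym (cong₂ _+_ (⟦⟧-true (isInvolution? v) v-inv) (⟦⟧-true (isInvolution? u) u-inv))))
        (ℕ.≤-trans (two-terms≤sum (λ g → ⟦ isInvolution? g ⟧) v≢u) count≤1)) λ { (s≤s ()) }
      -- A conjugate of `u` is again an involution, so uniqueness forces it to be `u`; hence `u` is
      -- central.
      conjugate-inv : ∀ x → IsInvolution (x \\ (u ∙ x))
      conjugate-inv x = nontrivial , trans (assoc (x ⁻¹) (u ∙ x) _) (trans (cong ((x ⁻¹) ∙_) square) (inverseˡ x))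
        where
        nontrivial : x \\ (u ∙ x) ≢ ε
        nontrivial eq = proj₁ u-inv (∙-cancelʳ x u ε (begin
          u ∙ x               ≡⟨ \\-leftDividesˡ x (u ∙ x) ⟨
          x ∙ (x \\ (u ∙ x))  ≡⟨ cong (x ∙_) eq ⟩
          x ∙ ε               ≡⟨ identityʳ x ⟩
          x                   ≡⟨ identityˡ x ⟨
          ε ∙ x               ∎))
        square : (u ∙ x) ∙ (x \\ (u ∙ x)) ≡ x
        square = begin
          (u ∙ x) ∙ (x \\ (u ∙ x))  ≡⟨ assoc u x _ ⟩
          u ∙ (x ∙ (x \\ (u ∙ x)))  ≡⟨ cong (u ∙_) (\\-leftDividesˡ x (u ∙ x)) ⟩
          u ∙ (u ∙ x)               ≡⟨ assoc u u x ⟨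
          (u ∙ u) ∙ x               ≡⟨ cong (_∙ x) (proj₂ u-inv) ⟩
          ε ∙ x                     ≡⟨ identityˡ x ⟩
          x                         ∎
      open Transfer u u-inv
      half : sum (𝟙 ∘ φ) ≡ 21
      -- 42 = 21 + 21 with 21 odd, so `φ u` is true and `φ` is onto.
      half = double-injective (sum (𝟙 ∘ φ)) 21 (φ-kernel (φ-central {21} central refl))
        where
        central : ∀ x → u ∙ x ≡ x ∙ u
        central x = trans (sym (\\-leftDividesˡ x (u ∙ x))) (cong (x ∙_) (unique (conjugate-inv x)))
      half′ : sum (𝟙 ∘ not ∘ φ) ≡ 21
      half′ = ℕ.+-cancelˡ-≡ 21 _ _ (trans (cong (_+ sum (𝟙 ∘ not ∘ φ)) (sym half)) (count-complement φ))
      -- Each of the 21 elements outside the kernel is a quotient at least once.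
      outside : 21 ≤ sum (λ i → sum (λ j → 𝟙 (φ (s i // s j))))
      outside = ℕ.≤-trans (ℕ.≤-reflexive (sym half))
        (ℕ.≤-trans (ℕ.≤-trans (ℕ.m≤m+n _ _) (ℕ.m≤m+n _ _)) (weighted-bound (𝟙 ∘ φ)))
      -- The kernel also has 21 elements, and `ε` among them occurs at least 6 further times.
      inside : 27 ≤ sum (λ i → sum (λ j → 𝟙 (not (φ (s i // s j)))))
      inside = ℕ.≤-trans (ℕ.≤-reflexive (sym (cong₂ (λ t b → t + 𝟙 (not b) * 6) half′ φ-ε)))
        (ℕ.≤-trans (ℕ.m≤m+n _ _) (weighted-bound (𝟙 ∘ not ∘ φ)))

    covering⇒order≤40 : ¬ Commutative _≡_ _∙_ → n ≤ 40
    covering⇒order≤40 non-comm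
      -- Read from the inside out: 43 is excluded first, then 42, then 41.
      = below (λ { refl → non-comm (prime⇒commutative (from-yes (prime? 41))) })
        (below covering⇒order≢42
        (below (λ { refl → non-comm (prime⇒commutative (from-yes (prime? 43))) }) n≤43))
      where
      below : ∀ {k} → n ≢ suc k → n ≤ suc k → n ≤ k
      below n≢1+k n≤1+k = ℕ.≤-pred (ℕ.≤∧≢⇒< n≤1+k n≢1+k)
      n≤43 : n ≤ 43
      -- Dropping the involutions leaves n + 6 ≤ 49 = 43 + 6.
      n≤43 = ℕ.+-cancelʳ-≤ 6 _ _ (ℕ.≤-trans (ℕ.m≤m+n _ _) order+involutions-bound)

-- Cardinalities of setoids

-- The bijection becomes a monomorphism into `Γ`, which reflects the group laws. It serves to move a
-- finite group onto `Fin n`, where equality is decidable, and to lift `Γ₁` to other universe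
-- levels.
transport : (Γ : Group c ℓ) (A : Setoid c′ ℓ′) → Inverse A (Group.setoid Γ) → Group c′ ℓ′
transport Γ A A↔Γ = record
  { isGroup = record
    { isMonoid = record
      { isSemigroup = record
        { isMagma = record { isEquivalence = Setoid.isEquivalence A ; ∙-cong = G.∙-cong }
        ; assoc   = G.assoc
        }
      ; identity = G.identity
      }
    ; inverse = G.inverse
    ; ⁻¹-cong = G.⁻¹-cong
    }
  }
  where
  module Γ = Group Γ
  open Inverse A↔Γ
  raw : RawGroup _ _
  raw = record
    { _≈_ = Setoid._≈_ A
    ; _∙_ = λ x y → from (to x Γ.∙ to y)
    ; ε   = from Γ.ε
    ; _⁻¹ = λ x → from (to x Γ.⁻¹)
    }
  to-isGroupMonomorphism : IsGroupMonomorphism raw Γ.rawGroup to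
  to-isGroupMonomorphism = record
    { isGroupHomomorphism = record
      { isMonoidHomomorphism = record
        { isMagmaHomomorphism = record
          { isRelHomomorphism = record { cong = to-cong }
          ; homo = λ x y → strictlyInverseˡ _
          }
        ; ε-homo = strictlyInverseˡ _
        }
      ; ⁻¹-homo = λ x → strictlyInverseˡ _
      }
    ; injective = λ {x} {y} tx≈ty → Setoid.trans A (Setoid.sym A (strictlyInverseʳ x)) (inverseʳ tx≈ty)
    }
  module G = IsGroup (Algebra.Morphism.GroupMonomorphism.isGroup to-isGroupMonomorphism Γ.isGroup)

restrict-inverse : {A : Setoid c ℓ} {B : Setoid c′ ℓ′} {P : Pred (Setoid.Carrier A) p} {Q : Pred (Setoid.Carrier B) q}
                   (I : Inverse A B) → (∀ {x} → P x → Q (Inverse.to I x)) → (∀ {y} → Q y → P (Inverse.from I y)) →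
                   Inverse (restrict A P) (restrict B Q)
restrict-inverse I P⇒Q Q⇒P = record
  { to        = λ (x , px) → to x , P⇒Q px
  ; from      = λ (y , qy) → from y , Q⇒P qy
  ; to-cong   = λ x≈y → to-cong x≈y
  ; from-cong = λ x≈y → from-cong x≈y
  ; inverse   = (λ y≈ → inverseˡ y≈) , (λ x≈ → inverseʳ x≈)
  }
  where open Inverse I

-- The members of `P` are numbered in increasing order. Equality sees only first projections, so
-- different proofs of membership receive the same number.
fin-subset-size : {P : Pred (Fin n) p} (P? : Decidable P) → HasSize (restrict (setoid (Fin n)) P) (count P?)
fin-subset-size {n = zero} P? = record
  { to = λ () ; from = λ () ; to-cong = λ { {()} } ; from-cong = λ { {()} }
  ; inverse = (λ { {()} }) , λ { {()} } }
fin-subset-size {n = suc n} {P = P} P? with P? zero | fin-subset-size (P? ∘ suc)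
... | no ¬p0 | I = record
  { to        = λ { (zero , p0) → contradiction p0 ¬p0 ; (suc i , pi) → I.to (i , pi) }
  ; from      = λ k → suc (proj₁ (I.from k)) , proj₂ (I.from k)
  ; to-cong   = λ { {zero , p0} → contradiction p0 ¬p0
                  ; {suc i , _} {suc .i , _} refl → I.to-cong refl }
  ; from-cong = cong suc ∘ I.from-cong
  ; inverse   = (λ { {y = zero , p0} → contradiction p0 ¬p0
                   ; {x} {suc .(proj₁ (I.from x)) , _} refl → I.inverseˡ refl })
              , (λ { {zero , p0} → contradiction p0 ¬p0 ; {suc i , _} eq → cong suc (I.inverseʳ eq) })
  }
  where module I = Inverse I
... | yes p0 | I = record
  { to        = λ { (zero , _) → zero ; (suc i , pi) → suc (I.to (i , pi)) }
  ; from      = λ { zero → zero , p0 ; (suc k) → suc (proj₁ (I.from k)) , proj₂ (I.from k) }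
  ; to-cong   = λ { {zero , _} {zero , _} _ → refl
                  ; {suc i , _} {suc .i , _} refl → cong suc (I.to-cong refl) }
  ; from-cong = λ { refl → refl }
  ; inverse   = (λ { {zero} {zero , _} _ → refl
                   ; {suc k} {suc .(proj₁ (I.from k)) , _} refl → cong suc (I.inverseˡ refl) })
              , (λ { {zero , _} {zero} _ → refl
                   ; {suc i , _} {suc k} eq → cong suc (I.inverseʳ (Fin.suc-injective eq)) })
  }
  where module I = Inverse I

subset-size : {A : Setoid c ℓ} (I : HasSize A n) {P : Pred (Setoid.Carrier A) p} →
              P Respects (Setoid._≈_ A) → (P? : Decidable P) →
              HasSize (restrict A P) (count (P? ∘ Inverse.from I))
subset-size {A = A} I P-resp P? = Inv.trans
  (restrict-inverse I (λ {x} → P-resp (Setoid.sym A (Inverse.strictlyInverseʳ I x))) id)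
  (fin-subset-size (P? ∘ Inverse.from I))

size-unique : {A : Setoid c ℓ} → HasSize A k → HasSize A n → k ≡ n
size-unique I J = ↔⇒≡ (Inv.trans (Inv.sym I) J)

-- Computing multiplicities of differences

module _ (Γ : Group c ℓ) {S : Pred (Group.Carrier Γ) p} (S-resp : S Respects Group._≈_ Γ) where

  private module Γ = Group Γ
  open Γ using (_≈_; _∙_; _//_)
  open Algebra.Properties.Group Γ using (//-rightDividesˡ; //-rightDividesʳ)

  -- A pair (t , t′) with t // t′ ≈ g is determined by t′.
  representations : ∀ g →
    Inverse (restrict (×-setoid Γ.setoid Γ.setoid) (λ (t , t′) → S t × S t′ × t // t′ ≈ g))
            (restrict Γ.setoid (λ t′ → S t′ × S (g ∙ t′)))
  representations g = record
    { to        = λ ((t , t′) , st , st′ , eq) → t′ , st′ , S-resp (solve t t′ eq) st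
    ; from      = λ (t′ , st′ , sgt′) → (g ∙ t′ , t′) , sgt′ , st′ , //-rightDividesʳ t′ g
    ; to-cong   = proj₂
    ; from-cong = λ eq → Γ.∙-congˡ eq , eq
    ; inverse   = proj₂
                , λ { {(t , t′) , _ , _ , eq} y≈t′ → Γ.trans (Γ.∙-congˡ y≈t′) (Γ.sym (solve t t′ eq)) , y≈t′ }
    }
    where
    solve : ∀ t t′ → t // t′ ≈ g → t ≈ g ∙ t′
    solve t t′ eq = Γ.trans (Γ.sym (//-rightDividesˡ t′ t)) (Γ.∙-congʳ eq)

  module Multiplicity (order : HasOrder Γ n) (S? : Decidable S) where

    -- By `representations`, only second components need counting, so one sum over the group
    -- replaces a sum over pairs.
    multiplicity : Γ.Carrier → ℕ
    multiplicity g = count (λ i → S? (Inverse.from order i) ×-dec S? (g ∙ Inverse.from order i))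

    occurs-multiplicity : ∀ g → Occurs Γ S (multiplicity g) g
    occurs-multiplicity g = Inv.trans (representations g)
      (subset-size order
        (λ x≈y (sx , sgx) → S-resp x≈y sx , S-resp (Γ.∙-congˡ x≈y) sgx)
        (λ t → S? t ×-dec S? (g ∙ t)))

    -- Cardinalities are unique; together with `occurs-multiplicity` this turns `Occurs` into a
    -- decidable equation between numbers.
    occurs⇒multiplicity : ∀ {g} → Occurs Γ S k g → k ≡ multiplicity g
    occurs⇒multiplicity {g = g} occ = size-unique occ (occurs-multiplicity g)

    multiplicity-cong : ∀ {g h} → g ≈ h → multiplicity g ≡ multiplicity h
    multiplicity-cong {g} {h} g≈h = sum-cong-≗ (λ i → let t = Inverse.from order i in
      ⟦⟧-cong (S? t ×-dec S? (g ∙ t)) (S? t ×-dec S? (h ∙ t))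
        (λ (st , sgt) → st , S-resp (Γ.∙-congʳ g≈h) sgt)
        (λ (st , sht) → st , S-resp (Γ.∙-congʳ (Γ.sym g≈h)) sht))

-- The upper bound for groups over arbitrary setoids

non-abelian-covering-order≤40 : ∀ n → NonAbelianCoveringOrder c ℓ p 7 n → n ≤ 40
non-abelian-covering-order≤40 n (Γ , order , non-abelian , S , S-size , covering) =
  covering⇒order≤40 G.isGroup s cover (λ comm → non-abelian (λ x y → to-injective (begin
    order.to (x Γ.∙ y)                        ≡⟨ to-∙ x y ⟩
    order.to x G.∙ order.to y                 ≡⟨ comm (order.to x) (order.to y) ⟩
    order.to y G.∙ order.to x                 ≡⟨ to-∙ y x ⟨
    order.to (y Γ.∙ x)                        ∎)))
  where
  open ≡-Reasoning
  module Γ = Group Γ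
  module order = Inverse order
  module size = Inverse (IsSubsetOfSize.size S-size)
  module G = Group (transport Γ (setoid (Fin n)) (Inv.sym order))
  to-injective : ∀ {x y} → order.to x ≡ order.to y → x Γ.≈ y
  to-injective {x} eq = Γ.trans (Γ.sym (order.strictlyInverseʳ x)) (order.inverseʳ eq)
  to-∙ : ∀ x y → order.to (x Γ.∙ y) ≡ order.to x G.∙ order.to y
  to-∙ x y = order.to-cong (Γ.sym (Γ.∙-cong (order.strictlyInverseʳ x) (order.strictlyInverseʳ y)))
  to-// : ∀ x y → order.to (x Γ.// y) ≡ order.to x G.// order.to y
  to-// x y = trans (to-∙ x (y Γ.⁻¹)) (cong (order.to x G.∙_)
                (order.to-cong (Γ.⁻¹-cong (Γ.sym (order.strictlyInverseʳ y)))))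
  s : Fin 7 → Fin n
  s i = order.to (proj₁ (size.from i))
  cover : ∀ g → ∃₂ λ i j → g ≡ s i G.// s j
  cover g with covering (order.from g)
  ... | t , t′ , t∈S , t′∈S , g≈t//t′ = size.to (t , t∈S) , size.to (t′ , t′∈S) , (begin
    g                                                    ≡⟨ order.strictlyInverseˡ g ⟨
    order.to (order.from g)                              ≡⟨ order.to-cong g≈t//t′ ⟩
    order.to (t Γ.// t′)                                 ≡⟨ to-// t t′ ⟩
    order.to t G.// order.to t′                          ≡⟨ cong₂ G._//_ (s-to t∈S) (s-to t′∈S) ⟨
    s (size.to (t , t∈S)) G.// s (size.to (t′ , t′∈S))   ∎)
    where
    -- The round trip through `size` may change the proof of membership, but the element stays the
    -- same up to `Γ.≈`.
    s-to : ∀ {t} (t∈S : S t) → s (size.to (t , t∈S)) ≡ order.to t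
    s-to t∈S = order.to-cong (size.strictlyInverseʳ (_ , t∈S))

-- The group Γ₁

open Presentation {r = 0ℓ} Generator using (Term; gen; ε; _∙_; _⁻¹)

private
  module Γ₁ = Group Γ₁
  open Γ₁ using (_≈_)

  a b : Term
  a = gen gen-a
  b = gen gen-b

  -- The pair (i , j) encodes the normal form `a ^ i ∙ b ^ j`.
  X : Set
  X = Fin 5 × Fin 8

a-shift b-shift : X ↔ X
-- Adding 4 inverts adding 1 modulo 5; in `b-shift`, adding 7 does so modulo 8.
a-shift = mk↔ₛ′ (λ (i , j) → (1 + Fin.toℕ i) ℕ.mod 5 , j) (λ (i , j) → (4 + Fin.toℕ i) ℕ.mod 5 , j)
  (λ (i , j) → cong (_, j) (from-yes (Fin.all? λ i → (1 + Fin.toℕ ((4 + Fin.toℕ i) ℕ.mod 5)) ℕ.mod 5 Fin.≟ i) i))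
  (λ (i , j) → cong (_, j) (from-yes (Fin.all? λ i → (4 + Fin.toℕ ((1 + Fin.toℕ i) ℕ.mod 5)) ℕ.mod 5 Fin.≟ i) i))
-- Here b ∙ a ^ i ≈ a ^ (i * 2) ∙ b, and 3 inverts 2 modulo 5.
b-shift = mk↔ₛ′ (λ (i , j) → (Fin.toℕ i * 2) ℕ.mod 5 , (1 + Fin.toℕ j) ℕ.mod 8)
                (λ (i , j) → (Fin.toℕ i * 3) ℕ.mod 5 , (7 + Fin.toℕ j) ℕ.mod 8)
  (λ (i , j) → cong₂ _,_
    (from-yes (Fin.all? λ i → (Fin.toℕ ((Fin.toℕ i * 3) ℕ.mod 5) * 2) ℕ.mod 5 Fin.≟ i) i)
    (from-yes (Fin.all? λ j → (1 + Fin.toℕ ((7 + Fin.toℕ j) ℕ.mod 8)) ℕ.mod 8 Fin.≟ j) j))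
  (λ (i , j) → cong₂ _,_
    (from-yes (Fin.all? λ i → (Fin.toℕ ((Fin.toℕ i * 2) ℕ.mod 5) * 3) ℕ.mod 5 Fin.≟ i) i)
    (from-yes (Fin.all? λ j → (7 + Fin.toℕ ((1 + Fin.toℕ j) ℕ.mod 8)) ℕ.mod 8 Fin.≟ j) j))

-- Left multiplication on the normal forms a ^ i ∙ b ^ j.
action : Term → X ↔ X
action (gen gen-a) = a-shift
action (gen gen-b) = b-shift
action ε           = Inv.↔-refl
action (u ∙ v)     = Inv.↔-trans (action v) (action u)
action (u ⁻¹)      = Inv.↔-sym (action u)

act : Term → X → X
act u = Inverse.to (action u)

all-X? : {P : Pred X p} → Decidable P → Dec (∀ x → P x)
all-X? P? = map′ (λ f (i , j) → f i j) (λ f i j → f (i , j)) (Fin.all? λ i → Fin.all? λ j → P? (i , j))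

_≟X_ : (x y : X) → Dec (x ≡ y)
_≟X_ = ≡-dec Fin._≟_ Fin._≟_

-- The relators are checked by evaluation at all 40 points, and the group axioms hold because terms
-- act by permutations. So the action descends to `Γ₁`.
act-cong : ∀ {u v} → u ≈ v → ∀ x → act u x ≡ act v x
act-cong (Presentation.relator a⁵≈1)     = from-yes (all-X? λ x → act (a ^ 5) x ≟X x)
act-cong (Presentation.relator b⁸≈1)     = from-yes (all-X? λ x → act (b ^ 8) x ≟X x)
act-cong (Presentation.relator bab⁻¹≈a²) =
  from-yes (all-X? λ x → act (b ∙ a ∙ b ⁻¹) x ≟X act (a ^ 2) x)
act-cong Presentation.refl               x = refl
act-cong (Presentation.sym u≈v)          x = sym (act-cong u≈v x)
act-cong (Presentation.trans u≈v v≈w)    x = trans (act-cong u≈v x) (act-cong v≈w x)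
act-cong (Presentation.∙-cong {u} {u′} {v} {v′} u≈u′ v≈v′) x =
  trans (cong (act u) (act-cong v≈v′ x)) (act-cong u≈u′ (act v′ x))
act-cong (Presentation.⁻¹-cong {u} {v} u≈v) x = begin
  act (u ⁻¹) x                          ≡⟨ cong (act (u ⁻¹)) (Inverse.strictlyInverseˡ (action v) x) ⟨
  act (u ⁻¹) (act v (act (v ⁻¹) x))     ≡⟨ cong (act (u ⁻¹)) (act-cong u≈v (act (v ⁻¹) x)) ⟨
  act (u ⁻¹) (act u (act (v ⁻¹) x))     ≡⟨ Inverse.strictlyInverseʳ (action u) (act (v ⁻¹) x) ⟩
  act (v ⁻¹) x                          ∎
  where open ≡-Reasoning
act-cong (Presentation.assoc u v w)      x = refl
act-cong (Presentation.identityˡ u)      x = refl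
act-cong (Presentation.identityʳ u)      x = refl
act-cong (Presentation.inverseˡ u)       x = Inverse.strictlyInverseʳ (action u) x
act-cong (Presentation.inverseʳ u)       x = Inverse.strictlyInverseˡ (action u) x

word : X → Term
word (i , j) = a ^ Fin.toℕ i ∙ b ^ Fin.toℕ j

normal-form : Term → X
normal-form t = act t (zero , zero)

-- With `act-cong`, different pairs give different elements of `Γ₁`, so there are at least 40.
normal-form-word : ∀ x → normal-form (word x) ≡ x
normal-form-word = from-yes (all-X? λ x → normal-form (word x) ≟X x)

-- Reduction of terms to normal form

module _ where
  open Relation.Binary.Reasoning.Setoid Γ₁.setoid

  ^-homo-+ : ∀ u m n → u ^ (m + n) ≈ u ^ m ∙ u ^ n
  ^-homo-+ u zero    n = Γ₁.sym (Γ₁.identityˡ (u ^ n))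
  ^-homo-+ u (suc m) n = Γ₁.trans (Γ₁.∙-congˡ (^-homo-+ u m n)) (Γ₁.sym (Γ₁.assoc u (u ^ m) (u ^ n)))

  ^-multiple : ∀ u m → u ^ m ≈ ε → ∀ k → u ^ (k * m) ≈ ε
  ^-multiple u m uᵐ≈ε zero    = Γ₁.refl
  ^-multiple u m uᵐ≈ε (suc k) = begin
    u ^ (m + k * m)        ≈⟨ ^-homo-+ u m (k * m) ⟩
    u ^ m ∙ u ^ (k * m)    ≈⟨ Γ₁.∙-cong uᵐ≈ε (^-multiple u m uᵐ≈ε k) ⟩
    ε ∙ ε                  ≈⟨ Γ₁.identityˡ ε ⟩
    ε                      ∎

  ^-mod : ∀ u m .{{_ : ℕ.NonZero m}} → u ^ m ≈ ε → ∀ k → u ^ k ≈ u ^ Fin.toℕ (k ℕ.mod m)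
  ^-mod u m uᵐ≈ε k = begin
    u ^ k                                    ≡⟨ cong (u ^_) (ℕ.m≡m%n+[m/n]*n k m) ⟩
    u ^ (k ℕ.% m + k ℕ./ m * m)              ≈⟨ ^-homo-+ u (k ℕ.% m) (k ℕ./ m * m) ⟩
    u ^ (k ℕ.% m) ∙ u ^ (k ℕ./ m * m)        ≈⟨ Γ₁.∙-congˡ (^-multiple u m uᵐ≈ε (k ℕ./ m)) ⟩
    u ^ (k ℕ.% m) ∙ ε                        ≈⟨ Γ₁.identityʳ _ ⟩
    u ^ (k ℕ.% m)                            ≡⟨ cong (u ^_) (Fin.toℕ-fromℕ< (ℕ.m%n<n k m)) ⟨
    u ^ Fin.toℕ (k ℕ.mod m)                  ∎

  ba≈a²b : b ∙ a ≈ a ^ 2 ∙ b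
  ba≈a²b = begin
    b ∙ a                 ≈⟨ Γ₁.identityʳ _ ⟨
    b ∙ a ∙ ε             ≈⟨ Γ₁.∙-congˡ (Γ₁.inverseˡ b) ⟨
    b ∙ a ∙ (b ⁻¹ ∙ b)  ≈⟨ Γ₁.assoc _ _ _ ⟨
    b ∙ a ∙ b ⁻¹ ∙ b    ≈⟨ Γ₁.∙-congʳ (Presentation.relator bab⁻¹≈a²) ⟩
    a ^ 2 ∙ b             ∎

  -- Each factor `a` is doubled as `b` moves past it; this brings a left factor `b` into normal
  -- form.
  baⁱ≈a²ⁱb : ∀ i → b ∙ a ^ i ≈ a ^ (i * 2) ∙ b
  baⁱ≈a²ⁱb zero    = Γ₁.trans (Γ₁.identityʳ b) (Γ₁.sym (Γ₁.identityˡ b))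
  baⁱ≈a²ⁱb (suc i) = begin
    b ∙ (a ∙ a ^ i)           ≈⟨ Γ₁.assoc _ _ _ ⟨
    b ∙ a ∙ a ^ i             ≈⟨ Γ₁.∙-congʳ ba≈a²b ⟩
    a ^ 2 ∙ b ∙ a ^ i         ≈⟨ Γ₁.assoc _ _ _ ⟩
    a ^ 2 ∙ (b ∙ a ^ i)       ≈⟨ Γ₁.∙-congˡ (baⁱ≈a²ⁱb i) ⟩
    a ^ 2 ∙ (a ^ (i * 2) ∙ b) ≈⟨ Γ₁.assoc _ _ _ ⟨
    a ^ 2 ∙ a ^ (i * 2) ∙ b   ≈⟨ Γ₁.∙-congʳ (^-homo-+ a 2 (i * 2)) ⟨
    a ^ (2 + i * 2) ∙ b        ∎

  -- Induction on the term shows that the action really is left multiplication in `Γ₁`, so products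
  -- with normal forms stay among the 40 of them.
  ∙-word : ∀ t x → t ∙ word x ≈ word (act t x)
  ∙-word (gen gen-a) (i , j) = Γ₁.trans (Γ₁.sym (Γ₁.assoc _ _ _))
    (Γ₁.∙-congʳ (^-mod a 5 (Presentation.relator a⁵≈1) (1 + Fin.toℕ i)))
  ∙-word (gen gen-b) (i , j) = begin
    b ∙ (a ^ i′ ∙ b ^ j′)          ≈⟨ Γ₁.assoc _ _ _ ⟨
    b ∙ a ^ i′ ∙ b ^ j′            ≈⟨ Γ₁.∙-congʳ (baⁱ≈a²ⁱb i′) ⟩
    a ^ (i′ * 2) ∙ b ∙ b ^ j′      ≈⟨ Γ₁.assoc _ _ _ ⟩
    a ^ (i′ * 2) ∙ b ^ (1 + j′)     ≈⟨ Γ₁.∙-cong (^-mod a 5 (Presentation.relator a⁵≈1) (i′ * 2))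
                                                  (^-mod b 8 (Presentation.relator b⁸≈1) (1 + j′)) ⟩
    word (act b (i , j))             ∎
    where
    i′ = Fin.toℕ i
    j′ = Fin.toℕ j
  ∙-word ε       x = Γ₁.identityˡ (word x)
  ∙-word (u ∙ v) x = begin
    u ∙ v ∙ word x             ≈⟨ Γ₁.assoc _ _ _ ⟩
    u ∙ (v ∙ word x)           ≈⟨ Γ₁.∙-congˡ (∙-word v x) ⟩
    u ∙ word (act v x)         ≈⟨ ∙-word u (act v x) ⟩
    word (act u (act v x))     ∎
  ∙-word (u ⁻¹)  x = begin
    -- Writing `x` as the image under `u` of its preimage lets the hypothesis for `u` produce a
    -- factor that cancels `u ⁻¹`.
    u ⁻¹ ∙ word x                        ≡⟨ cong (λ y → u ⁻¹ ∙ word y) (Inverse.strictlyInverseˡ (action u) x) ⟨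
    u ⁻¹ ∙ word (act u (act (u ⁻¹) x))   ≈⟨ Γ₁.∙-congˡ (∙-word u (act (u ⁻¹) x)) ⟨
    u ⁻¹ ∙ (u ∙ word (act (u ⁻¹) x))     ≈⟨ Algebra.Properties.Group.\\-leftDividesʳ Γ₁ u _ ⟩
    word (act (u ⁻¹) x)                  ∎

  word-normal-form : ∀ t → t ≈ word (normal-form t)
  word-normal-form t = begin
    t                       ≈⟨ Γ₁.identityʳ t ⟨
    -- `word (zero , zero)` computes to `ε ∙ ε`.
    t ∙ ε                   ≈⟨ Γ₁.∙-congˡ (Γ₁.identityʳ ε) ⟨
    t ∙ word (zero , zero)  ≈⟨ ∙-word t (zero , zero) ⟩
    word (normal-form t)    ∎

-- Order and word problem of `Γ₁`

Γ₁↔X : Inverse Γ₁.setoid (setoid X)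
Γ₁↔X = record
  { to        = normal-form
  ; from      = word
  ; to-cong   = λ u≈v → act-cong u≈v (zero , zero)
  ; from-cong = λ { refl → Γ₁.refl }
  ; inverse   = (λ {x} t≈w → trans (act-cong t≈w (zero , zero)) (normal-form-word x))
              , (λ {t} eq → Γ₁.trans (Γ₁.reflexive (cong word eq)) (Γ₁.sym (word-normal-form t)))
  }

Γ₁-order : HasOrder Γ₁ 40
Γ₁-order = Inv.trans Γ₁↔X (Inv.sym (Fin.*↔× {5} {8}))

_≈?_ : ∀ u v → Dec (u ≈ v)
u ≈? v = map′ (λ eq → Γ₁.trans (word-normal-form u) (Inverse.inverseʳ Γ₁↔X {v} {normal-form u} eq))
              (λ u≈v → act-cong u≈v (zero , zero))
              (normal-form u ≟X normal-form v)

-- The differences of `S₁`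

S₁-respects : S₁ Respects _≈_
S₁-respects = Membership.∈-resp-≈ Γ₁.setoid

S₁? : Decidable S₁
S₁? t = Any.any? (t ≈?_) _

open Multiplicity Γ₁ S₁-respects Γ₁-order S₁?

Γ₁-element : Fin 40 → Term
Γ₁-element = Inverse.from Γ₁-order

-- A finite table at the 40 normal forms, decided by evaluation; `multiplicity-cong` carries it to
-- any term.
multiplicity-1-or-2 : ∀ g → ¬ g ≈ ε → multiplicity g ≡ 1 ⊎ multiplicity g ≡ 2
multiplicity-1-or-2 g g≉ε = subst (λ k → k ≡ 1 ⊎ k ≡ 2) (multiplicity-cong i≈g)
  (table (Inverse.to Γ₁-order g) (g≉ε ∘ Γ₁.trans (Γ₁.sym i≈g)))
  where
  i≈g : Γ₁-element (Inverse.to Γ₁-order g) ≈ g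
  i≈g = Inverse.strictlyInverseʳ Γ₁-order g
  table : ∀ i → ¬ Γ₁-element i ≈ ε → multiplicity (Γ₁-element i) ≡ 1 ⊎ multiplicity (Γ₁-element i) ≡ 2
  table = from-yes (Fin.all? λ i → ¬? (Γ₁-element i ≈? ε) →-dec
    ((multiplicity (Γ₁-element i) ℕ.≟ 1) ⊎-dec (multiplicity (Γ₁-element i) ℕ.≟ 2)))

-- The listed terms have distinct normal forms, and the count over the 40 elements evaluates to 7.
S₁-size : IsSubsetOfSize Γ₁ S₁ 7
S₁-size = record { respects = S₁-respects ; size = subset-size Γ₁-order S₁-respects S₁? }

S₁-almost-difference-set : IsAlmostDifferenceSet Γ₁ S₁ 40 7 1 36
S₁-almost-difference-set = record
  { order      = Γ₁-order
  ; subset     = S₁-size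
  ; exactly-λ  = Inv.trans
      (restrict-inverse (Inv.refl Γ₁.setoid)
        (λ (g≉ε , occ) → g≉ε , sym (occurs⇒multiplicity occ))
        (λ {g} (g≉ε , eq) → g≉ε , subst (λ k → Occurs Γ₁ S₁ k g) eq (occurs-multiplicity g)))
      -- The count of non-identity elements of multiplicity 1 evaluates to 36.
      (subset-size Γ₁-order
        (λ g≈h (g≉ε , eq) → g≉ε ∘ Γ₁.trans g≈h , trans (sym (multiplicity-cong g≈h)) eq)
        (λ g → ¬? (g ≈? ε) ×-dec (multiplicity g ℕ.≟ 1)))
  ; others-λ+1 = λ g g≉ε ¬occ → [ (λ eq → contradiction (occurs g eq) ¬occ) , occurs g ]′ (multiplicity-1-or-2 g g≉ε)
  }
  where
  occurs : ∀ {k} g → multiplicity g ≡ k → Occurs Γ₁ S₁ k g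
  occurs g refl = occurs-multiplicity g

-- Every `g` other than `ε` has positive multiplicity, so its representations include one with index
-- `zero`.
S₁-covering : IsCovering Γ₁ S₁
S₁-covering g with g ≈? ε
... | yes g≈ε = ε , ε , ε∈S₁ , ε∈S₁ , Γ₁.trans g≈ε (Γ₁.sym (Γ₁.inverseʳ ε))
  where
  ε∈S₁ : S₁ ε
  ε∈S₁ = here Γ₁.refl
... | no g≉ε = witness (multiplicity-1-or-2 g g≉ε) (occurs-multiplicity g)
  where
  witness : ∀ {k} → k ≡ 1 ⊎ k ≡ 2 → Occurs Γ₁ S₁ k g → ∃[ t ] ∃[ t′ ] S₁ t × S₁ t′ × g ≈ t Γ₁.// t′
  first : ∀ {k} → Occurs Γ₁ S₁ (suc k) g → ∃[ t ] ∃[ t′ ] S₁ t × S₁ t′ × g ≈ t Γ₁.// t′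
  first occ with Inverse.from occ zero
  ... | (t , t′) , t∈S₁ , t′∈S₁ , eq = t , t′ , t∈S₁ , t′∈S₁ , Γ₁.sym eq
  witness (inj₁ refl) = first
  witness (inj₂ refl) = first

-- The normal forms of `a ∙ b` and `b ∙ a` are (1 , 1) and (2 , 1).
Γ₁-non-abelian : NonAbelian Γ₁
Γ₁-non-abelian comm = from-no ((a ∙ b) ≈? (b ∙ a)) (comm a b)

-- Attainment of order 40 at all universe levels

40-is-covering-order : (c ℓ p : Level) → NonAbelianCoveringOrder c ℓ p 7 40
40-is-covering-order c ℓ p =
    transport Γ₁ lifted lifted↔Γ₁
  , Inv.trans lifted↔Γ₁ Γ₁-order
  , (λ comm → Γ₁-non-abelian (λ x y → lower (comm (lift x) (lift y))))
  , Lift p ∘ S₁ ∘ lower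
  , record
    { respects = λ {x} {y} x≈y x∈S₁ → lift (S₁-respects {lower x} {lower y} (lower x≈y) (lower x∈S₁))
    ; size     = Inv.trans (restrict-inverse lifted↔Γ₁ lower lift) (IsSubsetOfSize.size S₁-size)
    }
  , λ g → let t , t′ , t∈S₁ , t′∈S₁ , eq = S₁-covering (lower g) in
          lift t , lift t′ , lift t∈S₁ , lift t′∈S₁ , lift eq
  where
  lifted : Setoid c ℓ
  lifted = record
    { Carrier       = Lift c Term
    ; _≈_           = λ x y → Lift ℓ (lower x ≈ lower y)
    ; isEquivalence = record
      { refl  = lift Γ₁.refl
      ; sym   = λ x≈y → lift (Γ₁.sym (lower x≈y))
      ; trans = λ x≈y y≈z → lift (Γ₁.trans (lower x≈y) (lower y≈z))
      }
    }
  lifted↔Γ₁ : Inverse lifted Γ₁.setoid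
  lifted↔Γ₁ = record
    { to        = lower
    ; from      = lift
    ; to-cong   = lower
    ; from-cong = lift
    ; inverse   = lower , lift
    }

proposition3p4 : (c ℓ p : Level) →
    IsMaximum (NonAbelianCoveringOrder c ℓ p 7) 40
    × IsAlmostDifferenceSet Γ₁ S₁ 40 7 1 36
proposition3p4 c ℓ p = (40-is-covering-order c ℓ p , non-abelian-covering-order≤40) , S₁-almost-difference-set
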